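{- Let $L$ be a finite loop, let $\psi\in\mathcal{Z}^2_{\mathcal{L}}(L)$ and let $f\in\mathcal{C}^1(L)$ be such that $\delta_\psi=\delta^2(f)$. Let $\phi_{\psi,f}\in\mathcal{C}^2(L)$ be defined by $\phi_{\psi,f}(a,b):=\psi(a,b)+f(ab)$ for all $a,b\in L$. Then the matrix $M_{\phi_{\psi,f}}$ is Hadamard equivalent to the cocyclic matrix $M_{\psi+\delta_f}$. As a consequence, $M_{\phi_{\psi,f}}$ is Hadamard if and only if $M_{\psi+\delta_f}$ is Hadamard.
   Context: A loop is a set $L$ with a binary operation (written by juxtaposition, not necessarily associative) having an identity element $e$ and such that for all $a,b\in L$ the equations $ax=b$ and $ya=b$ have unique solutions $x,y\in L$. $\mathcal{C}^k(L)$ is the set of all functions $L^k\to\mathbb{Z}_2$, with pointwise addition. For $f\in\mathcal{C}^1(L)$, $\delta_f\in\mathcal{C}^2(L)$ is $\delta_f(a,b):=f(a)+f(b)+f(ab)$; for $\psi\in\mathcal{C}^2(L)$, $\delta_\psi\in\mathcal{C}^3(L)$ is $\delta_\psi(a,b,c):=\psi(a,b)+\psi(b,c)+\psi(ab,c)+\psi(a,bc)$; and $\delta^2(f):=\delta_{\delta_f}$. A $2$-cocycle is $\psi\in\mathcal{C}^2(L)$ with $\delta_\psi=\mathbf{0}$; the matrix $M_\psi$ is called cocyclic over $L$ when $\psi$ is a $2$-cocycle. $\mathcal{Z}^2_{\mathcal{L}}(L)$ is the set of $2$-loop-cocycles: those $\psi\in\mathcal{C}^2(L)$ such that $\delta_\psi=\delta^2(f)$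 for some $f\in\mathcal{C}^1(L)$. For $\psi\in\mathcal{C}^2(L)$, $M_\psi$ is the matrix indexed by $L$ with $M_\psi[a,b]:=(-1)^{\psi(a,b)}$. A $\pm1$ matrix $M$ of order $n$ is Hadamard if $MM^T=nI_n$. Two $\pm 1$ matrices are Hadamard equivalent if one is obtained from the other by permutations and negations of rows and columns. -}

module Defs where

open import Algebra.Core using (Op₂)
open import Algebra.Structures using (IsLoop)
open import Data.Bool.Base using (if_then_else_)
open import Data.Fin.Base using (Fin)
import Data.Fin.Properties as Fin
open import Data.Integer.Base using (ℤ; +_; 0ℤ; 1ℤ; _◃_) renaming (_*_ to _*ℤ_)
import Data.Integer.Properties as ℤ
open import Data.Nat.Base using (ℕ)
open import Data.Parity.Base using (Parity; 0ℙ; _+_; toSign)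
open import Data.Product.Base using (∃-syntax)
open import Data.Sign.Base using (Sign; opposite)
open import Data.Vec.Base using (Vec; []; _∷_; [_])
open import Function.Base using (const)
open import Function.Bundles using (_↔_; Inverse)
open import Level using (Level; suc)
open import Relation.Binary.Construct.Closure.ReflexiveTransitive using (Star)
open import Relation.Binary.PropositionalEquality using (_≡_; _≢_; _≗_)
open import Relation.Nullary.Decidable using (does)

open import Algebra.Properties.CommutativeMonoid.Sum ℤ.+-0-commutativeMonoid using (sum)

private
  variable
    c : Level
    A : Set c
    n : ℕ

record FiniteLoop (c : Level) : Set (suc c) where
  infixl 7 _∙_ _\\_ _//_
  field
    Carrier     : Set c
    _∙_         : Op₂ Carrier
    _\\_        : Op₂ Carrier
    _//_        : Op₂ Carrier
    ε           : Carrier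
    isLoop      : IsLoop _≡_ _∙_ _\\_ _//_ ε
    order       : ℕ
    enumeration : Carrier ↔ Fin order

------------------------------------------------------------------------
-- Matrices with rows and columns indexed by a finite set A

SignMatrix : Set c → Set c
SignMatrix A = A → A → Sign

entry : SignMatrix A → A → A → ℤ
entry M a b = M a b ◃ 1

-- M Mᵀ; the value of the sum does not depend on the chosen enumeration.
gram : A ↔ Fin n → SignMatrix A → A → A → ℤ
gram e M a b = sum λ i → entry M a (from i) *ℤ entry M b (from i)
  where open Inverse e using (from)

identityMatrix : A ↔ Fin n → A → A → ℤ
identityMatrix e a b = if does (to a Fin.≟ to b) then 1ℤ else 0ℤ
  where open Inverse e using (to)

IsHadamard : A ↔ Fin n → SignMatrix A → Set _
IsHadamard {n = n} e M = ∀ a b → gram e M a b ≡ + n *ℤ identityMatrix e a b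

-- N arises from M by one elementary operation.  N is described entrywise,
-- because matrices are functions and extensionality is not available.
data Operation {A : Set c} (M N : SignMatrix A) : Set c where
  permuteRows : (σ : A ↔ A) →
                (∀ a b → N a b ≡ M (Inverse.to σ a) b) → Operation M N
  permuteCols : (σ : A ↔ A) →
                (∀ a b → N a b ≡ M a (Inverse.to σ b)) → Operation M N
  negateRow   : (r : A) →
                (∀ b → N r b ≡ opposite (M r b)) →
                (∀ a b → a ≢ r → N a b ≡ M a b) → Operation M N
  negateCol   : (s : A) →
                (∀ a → N a s ≡ opposite (M a s)) →
                (∀ a b → b ≢ s → N a b ≡ M a b) → Operation M N

HadamardEquivalent : {A : Set c} → SignMatrix A → SignMatrix A → Set c
HadamardEquivalent = Star Operation

------------------------------------------------------------------------
-- Cochains on a loop with values in ℤ₂, represented by Parity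

module Cochains {c} (L : FiniteLoop c) where

  open FiniteLoop L using (Carrier; _∙_; enumeration)

  𝒞 : ℕ → Set c
  𝒞 k = Vec Carrier k → Parity

  infixl 6 _⊕_

  _⊕_ : ∀ {k} → 𝒞 k → 𝒞 k → 𝒞 k
  (ψ ⊕ χ) as = ψ as + χ as

  𝟎 : ∀ {k} → 𝒞 k
  𝟎 = const 0ℙ

  δ₁ : 𝒞 1 → 𝒞 2
  δ₁ f (a ∷ b ∷ []) = f [ a ] + f [ b ] + f [ a ∙ b ]

  δ₂ : 𝒞 2 → 𝒞 3
  δ₂ ψ (a ∷ b ∷ c ∷ []) =
    ψ (a ∷ b ∷ []) + ψ (b ∷ c ∷ []) + ψ (a ∙ b ∷ c ∷ []) + ψ (a ∷ b ∙ c ∷ [])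

  δ² : 𝒞 1 → 𝒞 3
  δ² f = δ₂ (δ₁ f)

  IsCocycle : 𝒞 2 → Set c
  IsCocycle ψ = δ₂ ψ ≗ 𝟎

  IsLoopCocycle : 𝒞 2 → Set c
  IsLoopCocycle ψ = ∃[ f ] δ₂ ψ ≗ δ² f

  φ : 𝒞 2 → 𝒞 1 → 𝒞 2
  φ ψ f (a ∷ b ∷ []) = ψ (a ∷ b ∷ []) + f [ a ∙ b ]

  -- toSign p is (-1)ᵖ.
  matrix : 𝒞 2 → SignMatrix Carrier
  matrix ψ a b = toSign (ψ (a ∷ b ∷ []))

  Hadamard : SignMatrix Carrier → Set c
  Hadamard = IsHadamard enumeration

{-# OPTIONS --safe #-}

-- As δ is additive, δ(ψ + δ_f) = 2 δ²(f) = 0.  Since (ψ + δ_f)(a,b) =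
-- f(a) + f(b) + φ(a,b), the matrix of ψ + δ_f arises from that of φ by negating
-- the rows a with f(a) = 1 and the columns b with f(b) = 1.  A rescaling
-- N[a,b] = s(a) t(b) M[a,b] by signs multiplies the (a,b) entry of M Mᵀ by
-- s(a) s(b), which is 1 on the diagonal, so it preserves the Hadamard property;
-- being an involution, it also reflects it.
module Submission where

open import Defs
open import Data.Product.Base using (_×_)
open import Function.Bundles using (_⇔_)
open import Relation.Binary.PropositionalEquality using (_≗_)

open import Algebra.Properties.CommutativeSemigroup using (interchange; x∙yz≈y∙xz)
open import Data.Bool.Base using (if_then_else_)
open import Data.Fin.Base using (Fin)
import Data.Fin.Properties as Fin
open import Data.Integer.Base using (ℤ; +_; _◃_) renaming (_*_ to _*ℤ_)
import Data.Integer.Properties as ℤ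
open import Data.List.Base using (List; []; _∷_; tabulate)
open import Data.List.Membership.Propositional using (_∈_)
open import Data.List.Membership.Propositional.Properties using (∈-tabulate⁺)
open import Data.List.Relation.Unary.Any using (here; there)
open import Data.Nat.Base using (ℕ)
open import Data.Parity.Base using (_+_; toSign)
import Data.Parity.Properties as ℙ
open import Data.Product.Base using (_,_)
open import Data.Sign.Base as Sign using (Sign; opposite; _*_)
import Data.Sign.Properties as Sign
open import Data.Vec.Base using ([]; _∷_; [_])
open import Function.Base using (_∘_; flip)
open import Function.Bundles using (_↔_; Inverse; Injection; mk⇔)
open import Function.Construct.Identity using (↔-id)
open import Function.Properties.Inverse using (↔⇒↣)
open import Level using (Level)
open import Relation.Binary.Construct.Closure.ReflexiveTransitive using (ε; _◅_; _◅◅_; gmap)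
open import Relation.Binary.Definitions using (DecidableEquality)
open import Relation.Binary.PropositionalEquality
  using (_≡_; refl; sym; trans; cong; cong₂; subst; module ≡-Reasoning)
open import Relation.Nullary.Decidable using (does; yes; no; dec-true; dec-false)
open import Relation.Nullary.Negation using (contradiction)

open import Algebra.Properties.CommutativeMonoid.Sum ℤ.+-0-commutativeMonoid using (sum-cong-≗)
open import Algebra.Properties.Semiring.Sum ℤ.+-*-semiring using (*-distribˡ-sum)

open ≡-Reasoning

private
  variable
    c : Level
    A : Set c
    n : ℕ

Operation-transpose : {M N : SignMatrix A} → Operation M N → Operation (flip M) (flip N)
Operation-transpose (permuteRows σ eq)    = permuteCols σ (flip eq)
Operation-transpose (permuteCols σ eq)    = permuteRows σ (flip eq)
Operation-transpose (negateRow r eq rest) = negateCol r eq (flip rest)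
Operation-transpose (negateCol s eq rest) = negateRow s eq (flip rest)

-- Transposition exchanges the row and column operations one for one, so scaling columns reduces to
-- scaling rows.
HadamardEquivalent-transpose : {M N : SignMatrix A} →
  HadamardEquivalent M N → HadamardEquivalent (flip M) (flip N)
HadamardEquivalent-transpose = gmap flip Operation-transpose

module _ {A : Set c} (_≟_ : DecidableEquality A) where

  negatedRow : A → SignMatrix A → SignMatrix A
  negatedRow r M a b = if does (a ≟ r) then opposite (M a b) else M a b

  negatedRow-operation : ∀ r M → Operation M (negatedRow r M)
  negatedRow-operation r M = negateRow r
    (λ b → cong (if_then opposite (M r b) else M r b) (dec-true (r ≟ r) refl))
    (λ a b a≢r → cong (if_then opposite (M a b) else M a b) (dec-false (a ≟ r) a≢r))

  -- Induction on a list that covers the rows of negative sign. It may also hold rows of positive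
  -- sign, which are skipped, and repetitions.
  scaleListedRows : (xs : List A) (s : A → Sign) (M N : SignMatrix A) →
    (∀ a → s a ≡ Sign.- → a ∈ xs) →
    (∀ a b → N a b ≡ s a * M a b) → HadamardEquivalent M N
  -- No negative sign is left, so `N` agrees with `M`, but only entrywise; the identity permutation
  -- turns this agreement into an operation.
  scaleListedRows [] s M N neg∈ eq = permuteRows (↔-id _) unscaled ◅ ε
    where
    unscaled : ∀ a b → N a b ≡ M a b
    unscaled a b with s a in sa≡ | eq a b
    ... | Sign.+ | Nab≡ = Nab≡
    ... | Sign.- | _    = contradiction (neg∈ a sa≡) λ ()
  scaleListedRows (x ∷ xs) s M N neg∈ eq with s x in sx≡
  ... | Sign.+ = scaleListedRows xs s M N neg∈′ eq
    where
    neg∈′ : ∀ a → s a ≡ Sign.- → a ∈ xs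
    neg∈′ a sa≡- with neg∈ a sa≡-
    ... | there a∈xs = a∈xs
    ... | here refl  = contradiction (trans (sym sx≡) sa≡-) λ ()
  ... | Sign.- = negatedRow-operation x M ◅ scaleListedRows xs s′ (negatedRow x M) N neg∈′ eq′
    where
    -- Row `x` has just been negated, so its sign becomes `+`; a later occurrence of `x` in the list
    -- is then skipped.
    s′ : A → Sign
    s′ a = if does (a ≟ x) then Sign.+ else s a

    neg∈′ : ∀ a → s′ a ≡ Sign.- → a ∈ xs
    neg∈′ a s′a≡- with a ≟ x
    ... | no a≢x with neg∈ a s′a≡-
    ...   | there a∈xs = a∈xs
    ...   | here a≡x   = contradiction a≡x a≢x

    eq′ : ∀ a b → N a b ≡ s′ a * negatedRow x M a b
    eq′ a b with a ≟ x
    ... | yes refl = trans (eq a b) (cong (_* M a b) sx≡)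
    ... | no _     = eq a b

module _ {A : Set c} (e : A ↔ Fin n) where

  open Inverse e using (to; from; strictlyInverseʳ)

  scaleRows : (s : A → Sign) {M N : SignMatrix A} →
    (∀ a b → N a b ≡ s a * M a b) → HadamardEquivalent M N
  -- Every element is listed, hence in particular those of negative sign. Equality is decided by
  -- comparing indices in `Fin n`.
  scaleRows s {M} {N} = scaleListedRows (Fin.inj⇒≟ (↔⇒↣ e)) (tabulate from) s M N
    λ a _ → subst (_∈ tabulate from) (strictlyInverseʳ a) (∈-tabulate⁺ (to a))

  scaleCols : (t : A → Sign) {M N : SignMatrix A} →
    (∀ a b → N a b ≡ t b * M a b) → HadamardEquivalent M N
  scaleCols t eq = HadamardEquivalent-transpose (scaleRows t (flip eq))

-- In matrix terms, N = D M E with D and E the diagonal matrices of the signs `s` and `t`. Being a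
-- record, it lets `s`, `t`, `M` and `N` be inferred from a proof.
record Rescaling {A : Set c} (s t : A → Sign) (M N : SignMatrix A) : Set c where
  constructor rescaling
  field
    rescaled : ∀ a b → N a b ≡ s a * t b * M a b

module _ {s t : A → Sign} {M N : SignMatrix A} where

  Rescaling-sym : Rescaling s t M N → Rescaling s t N M
  Rescaling-sym (rescaling eq) = rescaling λ a b → begin
    M a b                              ≡⟨ cong (_* M a b) (Sign.s*s≡+ (s a * t b)) ⟨
    (s a * t b) * (s a * t b) * M a b  ≡⟨ Sign.*-assoc (s a * t b) _ _ ⟩
    s a * t b * (s a * t b * M a b)    ≡⟨ cong (s a * t b *_) (eq a b) ⟨
    s a * t b * N a b                  ∎

  Rescaling⇒HadamardEquivalent : A ↔ Fin n → Rescaling s t M N → HadamardEquivalent M N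
  Rescaling⇒HadamardEquivalent e (rescaling eq) =
    -- The reflexivity proof fixes the intermediate matrix, with entries `t b * M a b`.
    scaleCols e t (λ _ _ → refl) ◅◅
    scaleRows e s (λ a b → trans (eq a b) (Sign.*-assoc (s a) (t b) (M a b)))

  -- The column sign `t i` occurs twice and squares to `+`. What remains, `s a * s b`, is
  -- independent of `i` and can leave the sum over `i`.
  entry-Rescaling : Rescaling s t M N → ∀ a b i →
    entry N a i *ℤ entry N b i ≡ (s a * s b ◃ 1) *ℤ (entry M a i *ℤ entry M b i)
  entry-Rescaling (rescaling eq) a b i = begin
    entry N a i *ℤ entry N b i
      ≡⟨ ℤ.◃-distrib-* (N a i) (N b i) 1 1 ⟨
    N a i * N b i ◃ 1
      ≡⟨ cong (_◃ 1) (cong₂ _*_ (eq a i) (eq b i)) ⟩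
    (s a * t i * M a i) * (s b * t i * M b i) ◃ 1
      ≡⟨ cong (_◃ 1) (swap (s a * t i) (M a i) (s b * t i) (M b i)) ⟩
    (s a * t i) * (s b * t i) * (M a i * M b i) ◃ 1
      ≡⟨ cong (λ r → r * (M a i * M b i) ◃ 1) (swap (s a) (t i) (s b) (t i)) ⟩
    s a * s b * (t i * t i) * (M a i * M b i) ◃ 1
      ≡⟨ cong (λ r → s a * s b * r * (M a i * M b i) ◃ 1) (Sign.s*s≡+ (t i)) ⟩
    s a * s b * Sign.+ * (M a i * M b i) ◃ 1
      ≡⟨ cong (λ r → r * (M a i * M b i) ◃ 1) (Sign.*-identityʳ (s a * s b)) ⟩
    s a * s b * (M a i * M b i) ◃ 1
      ≡⟨ ℤ.◃-distrib-* (s a * s b) (M a i * M b i) 1 1 ⟩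
    (s a * s b ◃ 1) *ℤ (M a i * M b i ◃ 1)
      ≡⟨ cong ((s a * s b ◃ 1) *ℤ_) (ℤ.◃-distrib-* (M a i) (M b i) 1 1) ⟩
    (s a * s b ◃ 1) *ℤ (entry M a i *ℤ entry M b i) ∎
    where swap = interchange Sign.*-commutativeSemigroup

  gram-Rescaling : (e : A ↔ Fin n) → Rescaling s t M N → ∀ a b →
    gram e N a b ≡ (s a * s b ◃ 1) *ℤ gram e M a b
  gram-Rescaling e eq a b = trans
    (sum-cong-≗ (entry-Rescaling eq a b ∘ Inverse.from e))
    (sym (*-distribˡ-sum (s a * s b ◃ 1)
      λ i → entry M a (Inverse.from e i) *ℤ entry M b (Inverse.from e i)))

-- Off the diagonal both sides vanish; on it the factor is the square of a sign.
identityMatrix-rescale : (e : A ↔ Fin n) (s : A → Sign) (k : ℤ) → ∀ a b →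
  (s a * s b ◃ 1) *ℤ (k *ℤ identityMatrix e a b) ≡ k *ℤ identityMatrix e a b
identityMatrix-rescale e s k a b with Inverse.to e a Fin.≟ Inverse.to e b
... | no _ rewrite ℤ.*-zeroʳ k = ℤ.*-zeroʳ (s a * s b ◃ 1)
-- Equal indices give `a ≡ b`, because an enumeration is injective.
... | yes eq with refl ← Injection.injective (↔⇒↣ e) eq
    rewrite Sign.s*s≡+ (s a) = ℤ.*-identityˡ _

Rescaling⇒IsHadamard : (e : A ↔ Fin n) {s t : A → Sign} {M N : SignMatrix A} →
  Rescaling s t M N → IsHadamard e M → IsHadamard e N
Rescaling⇒IsHadamard {n = n} e {s} {M = M} {N} eq hM a b = begin
  gram e N a b                                        ≡⟨ gram-Rescaling e eq a b ⟩
  (s a * s b ◃ 1) *ℤ gram e M a b                     ≡⟨ cong ((s a * s b ◃ 1) *ℤ_) (hM a b) ⟩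
  (s a * s b ◃ 1) *ℤ (+ n *ℤ identityMatrix e a b)    ≡⟨ identityMatrix-rescale e s (+ n) a b ⟩
  + n *ℤ identityMatrix e a b                         ∎

module _ (L : FiniteLoop c) where

  open FiniteLoop L using (Carrier; _∙_)
  open Cochains L

  δ₂-⊕ : (ψ χ : 𝒞 2) → δ₂ (ψ ⊕ χ) ≗ δ₂ ψ ⊕ δ₂ χ
  δ₂-⊕ ψ χ (a ∷ b ∷ c ∷ []) = begin
    (ψ₁ + χ₁) + (ψ₂ + χ₂) + (ψ₃ + χ₃) + (ψ₄ + χ₄)
      ≡⟨ cong (λ p → p + (ψ₃ + χ₃) + (ψ₄ + χ₄)) (swap ψ₁ χ₁ ψ₂ χ₂) ⟩
    (ψ₁ + ψ₂) + (χ₁ + χ₂) + (ψ₃ + χ₃) + (ψ₄ + χ₄)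
      ≡⟨ cong (_+ (ψ₄ + χ₄)) (swap (ψ₁ + ψ₂) (χ₁ + χ₂) ψ₃ χ₃) ⟩
    (ψ₁ + ψ₂ + ψ₃) + (χ₁ + χ₂ + χ₃) + (ψ₄ + χ₄)
      ≡⟨ swap (ψ₁ + ψ₂ + ψ₃) (χ₁ + χ₂ + χ₃) ψ₄ χ₄ ⟩
    (ψ₁ + ψ₂ + ψ₃ + ψ₄) + (χ₁ + χ₂ + χ₃ + χ₄) ∎
    where
    swap = interchange ℙ.+-commutativeSemigroup
    ψ₁ = ψ (a ∷ b ∷ [])
    ψ₂ = ψ (b ∷ c ∷ [])
    ψ₃ = ψ (a ∙ b ∷ c ∷ [])
    ψ₄ = ψ (a ∷ b ∙ c ∷ [])
    χ₁ = χ (a ∷ b ∷ [])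
    χ₂ = χ (b ∷ c ∷ [])
    χ₃ = χ (a ∙ b ∷ c ∷ [])
    χ₄ = χ (a ∷ b ∙ c ∷ [])

  -- By additivity the coboundary of the sum is twice a common value, which is zero in ℤ₂.
  δ₂-agree⇒IsCocycle : (ψ χ : 𝒞 2) → δ₂ ψ ≗ δ₂ χ → IsCocycle (ψ ⊕ χ)
  δ₂-agree⇒IsCocycle ψ χ eq as = begin
    δ₂ (ψ ⊕ χ) as     ≡⟨ δ₂-⊕ ψ χ as ⟩
    δ₂ ψ as + δ₂ χ as ≡⟨ cong (_+ δ₂ χ as) (eq as) ⟩
    δ₂ χ as + δ₂ χ as ≡⟨ ℙ.p+p≡0ℙ (δ₂ χ as) ⟩
    𝟎 as              ∎

  coboundarySign : 𝒞 1 → Carrier → Sign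
  coboundarySign f a = toSign (f [ a ])

  -- The term f(ab) is grouped with ψ(a,b) to form φ(a,b); the remaining f(a) and f(b) become the
  -- row and column signs, since `toSign` turns sums into products.
  φ-Rescaling : (ψ : 𝒞 2) (f : 𝒞 1) →
    Rescaling (coboundarySign f) (coboundarySign f) (matrix (φ ψ f)) (matrix (ψ ⊕ δ₁ f))
  φ-Rescaling ψ f = rescaling λ a b → let p = ψ (a ∷ b ∷ []) in begin
    toSign (p + (f [ a ] + f [ b ] + f [ a ∙ b ]))
      ≡⟨ cong toSign (x∙yz≈y∙xz ℙ.+-commutativeSemigroup p (f [ a ] + f [ b ]) _) ⟩
    toSign (f [ a ] + f [ b ] + (p + f [ a ∙ b ]))
      ≡⟨ ℙ.+-homo-* (f [ a ] + f [ b ]) _ ⟩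
    toSign (f [ a ] + f [ b ]) * toSign (p + f [ a ∙ b ])
      ≡⟨ cong (_* toSign (p + f [ a ∙ b ])) (ℙ.+-homo-* (f [ a ]) (f [ b ])) ⟩
    toSign (f [ a ]) * toSign (f [ b ]) * toSign (p + f [ a ∙ b ]) ∎

lemma19 : ∀ {c} (L : FiniteLoop c) → let open Cochains L in
    (ψ : 𝒞 2) → IsLoopCocycle ψ →
    (f : 𝒞 1) → δ₂ ψ ≗ δ² f →
    IsCocycle (ψ ⊕ δ₁ f)
    × HadamardEquivalent (matrix (φ ψ f)) (matrix (ψ ⊕ δ₁ f))
    × (Hadamard (matrix (φ ψ f)) ⇔ Hadamard (matrix (ψ ⊕ δ₁ f)))
lemma19 L ψ _ f δψ≗δ²f =
    -- The second cochain is δ_f, whose coboundary is δ²(f) by definition.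
    δ₂-agree⇒IsCocycle L ψ (Cochains.δ₁ L f) δψ≗δ²f
  , Rescaling⇒HadamardEquivalent enumeration φ-rescaling
  , mk⇔ (Rescaling⇒IsHadamard enumeration φ-rescaling)
        (Rescaling⇒IsHadamard enumeration (Rescaling-sym φ-rescaling))
  where
  open FiniteLoop L using (enumeration)
  φ-rescaling = φ-Rescaling L ψ f
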